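{- Let $\mathcal R$ be a minion, let $k\in\mathbb N$ ($k\ge 1$), and let $\mathcal D$ be a connected LC instance. Then the $k$-th saturated power $\mathrm{pow}_k\,\mathcal D$ has a solution in $\mathcal R$ if and only if $\mathcal D$ has a solution in the minion $\mathrm{lvl}_k\,\mathcal R$.
   Context: An LC (label cover) instance $\mathcal D$ consists of a finite set $X$ of variables, a finite set $\mathcal D_x$ (domain) for each $x\in X$, and a finite list of constraints of the form $x=\alpha(y)$ with $x,y\in X$ and $\alpha:\mathcal D_y\to\mathcal D_x$ a function. A solution is a tuple $(d_x)_{x\in X}$ with $d_x\in\mathcal D_x$ and $d_x=\alpha(d_y)$ for every constraint $x=\alpha(y)$. The shape of $\mathcal D$ is the directed multigraph with vertex set $X$ and an arc from $y$ to $x$ for each constraint $x=\alpha(y)$; $\mathcal D$ is connected if its shape is connected (as an undirected graph), and discrete if it has no constraints. A minion $\mathcal R$ is a functor from finite sets to sets: it assigns a set $\mathcal R^{(D)}$ to each finite set $D$ and a map $\mathcal R^{(\alpha)}:\mathcal R^{(D)}\to\mathcal R^{(E)}$ to each function $\alpha:D\to E$ between finite sets, with $\mathcal R^{(\mathrm{id}_D)}=\mathrm{id}$ and $\mathcal R^{(\alpha)}\circ\mathcal R^{(\beta)}=\mathcal R^{(\alpha\circ\beta)}$. A solution of $\mathcal D$ in $\mathcal R$ (equivalently, a solution of $\mathcal R\circ\mathcal D$) is a tuple $(r_x)_{x\in X}$ with $r_x\in\mathcal R^{(\mathcal D_x)}$ and $r_x=\mathcal R^{(\alpha)}(r_y)$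 for every constraint $x=\alpha(y)$ of $\mathcal D$. The $k$-th saturated power $\mathrm{pow}_k\,\mathcal D$ is the LC instance with variable set $X^k$, domains $\mathcal D_{x_1x_2\dots x_k}=\mathcal D_{x_1}\times\cdots\times\mathcal D_{x_k}$, and the following constraints, where first all constraints $x=\mathrm{id}(x)$ ($x\in X$) are added to $\mathcal D$: (1) for every $k$-tuple of constraints $x_i=\alpha_i(y_i)$, $i=1,\dots,k$, of $\mathcal D$, the constraint $x_1\dots x_k=(\alpha_1\times\cdots\times\alpha_k)(y_1\dots y_k)$; (2) for every $x_1\dots x_k\in X^k$ and every function $\sigma:[k]\to[k]$, the constraint $x_{\sigma(1)}\dots x_{\sigma(k)}=\sigma^*(x_1\dots x_k)$, where $\sigma^*(d_1\dots d_k)=d_{\sigma(1)}\dots d_{\sigma(k)}$. The $k$-th level $\mathrm{lvl}_k\,\mathcal R$ of $\mathcal R$ is the minion defined as follows. Elements of $(\mathrm{lvl}_k\,\mathcal R)^{(A)}$ are triples $(\mathcal E,r,\omega)$ where $\mathcal E$ is a discrete LC instance with variable set $Y$; $r=(r_{\bar y})_{\bar y\in Y^k}$ is a solution of $\mathrm{pow}_k\,\mathcal E$ in $\mathcal R$; and $\omega=(\omega_{\bar y})_{\bar y\in Y^{k-1}}$ is a tuple with $\omega_{\bar y}\in\mathcal R^{(A\times\mathcal E_{y_1}\times\cdots\times\mathcal E_{y_{k-1}})}$ such that there exist $z\in Y$ and a map $\beta:\mathcal E_z\to A$ with $\omega_{\bar y}=\mathcal R^{(\beta\times\mathrm{id}\times\cdots\times\mathrm{id})}(r_{zy_1\dots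 y_{k-1}})$ for all $\bar y\in Y^{k-1}$. For $\alpha:A\to B$, $(\mathrm{lvl}_k\,\mathcal R)^{(\alpha)}(\mathcal E,r,\omega)=(\mathcal E,r,\omega')$ with $\omega'_{\bar y}=\mathcal R^{(\alpha\times\mathrm{id}\times\cdots\times\mathrm{id})}(\omega_{\bar y})$. -}

module Defs where

open import Level using (Level; _⊔_) renaming (suc to lsuc; zero to lzero)
open import Data.Empty using (⊥)
open import Data.Fin using (Fin)
open import Data.Fin.Properties using (+↔⊎; *↔×; 1↔⊤)
open import Data.Irrelevant as Irr using (Irrelevant)
open import Data.Nat using (ℕ; zero; suc; NonZero)
open import Data.Product using (Σ; _×_; _,_; ∃-syntax; uncurry)
open import Data.Product.Function.NonDependent.Propositional using (_×-↔_)
open import Data.Sum using (_⊎_; inj₁; inj₂; [_,_])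
open import Data.Sum.Function.Propositional using (_⊎-↔_)
open import Data.Unit using (⊤; tt)
open import Data.Vec as Vec using (Vec; []; _∷_)
open import Data.Vec.Relation.Unary.All as All using (All; []; _∷_)
open import Data.Vec.Relation.Unary.All.Properties using (lookup⁺)
open import Function using (_∘_; id; _↔_; mk↔ₛ′)
open import Function.Construct.Composition using (_↔-∘_)
open import Function.Construct.Identity using (↔-id)
open import Function.Construct.Symmetry using (↔-sym)
open import Relation.Binary using (Setoid)
open import Relation.Binary.Construct.Closure.Equivalence using (EqClosure)
open import Relation.Binary.PropositionalEquality
  using (_≡_; refl; sym; trans; cong; cong₂; subst; _≗_; subst-subst; subst-sym-subst)

------------------------------------------------------------------------
-- Finite sets

-- Finiteness is a property, not a chosen enumeration: it is kept
-- irrelevant, so that finite sets with equal carriers are equal.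
IsFinite : Set → Set
IsFinite A = Irrelevant (∃[ n ] (A ↔ Fin n))

record FinSet : Set₁ where
  constructor finSet
  field
    ∣_∣    : Set
    finite : IsFinite ∣_∣
open FinSet public

finite-↔ : {A B : Set} → A ↔ B → IsFinite B → IsFinite A
finite-↔ f = Irr.map λ (n , g) → n , (g ↔-∘ f)

finite-⊥ : IsFinite ⊥
finite-⊥ = Irr.pure (0 , mk↔ₛ′ (λ ()) (λ ()) (λ ()) (λ ()))

finite-⊤ : IsFinite ⊤
finite-⊤ = Irr.pure (1 , ↔-sym 1↔⊤)

finite-Fin : ∀ n → IsFinite (Fin n)
finite-Fin n = Irr.pure (n , ↔-id (Fin n))

finite-⊎ : {A B : Set} → IsFinite A → IsFinite B → IsFinite (A ⊎ B)
finite-⊎ = Irr.zipWith λ (_ , f) (_ , g) → _ , (↔-sym +↔⊎ ↔-∘ (f ⊎-↔ g))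

finite-× : {A B : Set} → IsFinite A → IsFinite B → IsFinite (A × B)
finite-× = Irr.zipWith λ (_ , f) (_ , g) → _ , (↔-sym *↔× ↔-∘ (f ×-↔ g))

finite-Vec : {A : Set} → IsFinite A → ∀ n → IsFinite (Vec A n)
finite-Vec fin zero = finite-↔
  (mk↔ₛ′ (λ _ → tt) (λ _ → []) (λ _ → refl) (λ { [] → refl })) finite-⊤
finite-Vec fin (suc n) = finite-↔
  (mk↔ₛ′ Vec.uncons (uncurry _∷_) (λ _ → refl) (λ { (_ ∷ _) → refl }))
  (finite-× fin (finite-Vec fin n))

finite-All : {A : Set} {P : A → Set} → (∀ x → IsFinite (P x)) →
             ∀ {n} (xs : Vec A n) → IsFinite (All P xs)
finite-All fin [] = finite-↔
  (mk↔ₛ′ (λ _ → tt) (λ _ → []) (λ _ → refl) (λ { [] → refl })) finite-⊤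
finite-All fin (x ∷ xs) = finite-↔
  (mk↔ₛ′ All.uncons (uncurry _∷_) (λ _ → refl) (λ { (_ ∷ _) → refl }))
  (finite-× (fin x) (finite-All fin xs))

⊥ᶠ : FinSet
⊥ᶠ = finSet ⊥ finite-⊥

Finᶠ : ℕ → FinSet
Finᶠ n = finSet (Fin n) (finite-Fin n)

infixr 1 _⊎ᶠ_
infixr 2 _×ᶠ_

_⊎ᶠ_ _×ᶠ_ : FinSet → FinSet → FinSet
A ⊎ᶠ B = finSet (∣ A ∣ ⊎ ∣ B ∣) (finite-⊎ (finite A) (finite B))
A ×ᶠ B = finSet (∣ A ∣ × ∣ B ∣) (finite-× (finite A) (finite B))

_^ᶠ_ : FinSet → ℕ → FinSet
A ^ᶠ n = finSet (Vec ∣ A ∣ n) (finite-Vec (finite A) n)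

-- The product F x₁ × ⋯ × F xₙ.
Πᶠ : {X : Set} (F : X → FinSet) {n : ℕ} → Vec X n → FinSet
Πᶠ F xs = finSet (All (∣_∣ ∘ F) xs) (finite-All (finite ∘ F) xs)

------------------------------------------------------------------------
-- Label cover instances

-- The list of constraints is given as a family indexed by a finite set
-- of arcs; the arc c stands for the constraint
-- target c = fun c (source c).
record LC : Set₁ where
  field
    vars   : FinSet
    dom    : ∣ vars ∣ → FinSet
    arcs   : FinSet
    source : ∣ arcs ∣ → ∣ vars ∣
    target : ∣ arcs ∣ → ∣ vars ∣
    fun    : (c : ∣ arcs ∣) → ∣ dom (source c) ∣ → ∣ dom (target c) ∣

discrete : (Y : FinSet) → (∣ Y ∣ → FinSet) → LC
discrete Y F = record
  { vars = Y ; dom = F ; arcs = ⊥ᶠ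
  ; source = λ () ; target = λ () ; fun = λ () }

module _ (𝒟 : LC) where
  open LC 𝒟

  Adjacent : ∣ vars ∣ → ∣ vars ∣ → Set
  Adjacent y x = ∃[ c ] (source c ≡ y × target c ≡ x)

  -- The empty instance counts as connected.
  Connected : Set
  Connected = ∀ x y → EqClosure Adjacent x y

------------------------------------------------------------------------
-- Minions

-- Functors from finite sets to sets, a set being a setoid and equality
-- of functions being pointwise.
record Minion (c ℓ : Level) : Set (lsuc (lsuc lzero ⊔ c ⊔ ℓ)) where
  field
    obj : FinSet → Setoid c ℓ

  Elem : FinSet → Set c
  Elem A = Setoid.Carrier (obj A)

  infix 4 _≈_
  _≈_ : {A : FinSet} → Elem A → Elem A → Set ℓ
  _≈_ {A} = Setoid._≈_ (obj A)

  field
    map      : {A B : FinSet} → (∣ A ∣ → ∣ B ∣) → Elem A → Elem B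
    map-cong : {A B : FinSet} {α β : ∣ A ∣ → ∣ B ∣} {r s : Elem A} →
               α ≗ β → r ≈ s → map {A} {B} α r ≈ map {A} {B} β s
    map-id   : {A : FinSet} (r : Elem A) → map id r ≈ r
    map-∘    : {A B C : FinSet} (α : ∣ B ∣ → ∣ C ∣) (β : ∣ A ∣ → ∣ B ∣) (r : Elem A) →
               map {B} {C} α (map {A} {B} β r) ≈ map {A} {C} (α ∘ β) r

record Solution {c ℓ} (𝒟 : LC) (R : Minion c ℓ) : Set (c ⊔ ℓ) where
  open LC 𝒟
  open Minion R
  field
    val       : (x : ∣ vars ∣) → Elem (dom x)
    satisfied : (c : ∣ arcs ∣) → val (target c) ≈ map (fun c) (val (source c))
open Solution public

------------------------------------------------------------------------
-- Saturated powers

addIdentities : LC → LC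
addIdentities 𝒟 = record
  { vars   = vars
  ; dom    = dom
  ; arcs   = arcs ⊎ᶠ vars
  ; source = [ source , id ]
  ; target = [ target , id ]
  ; fun    = λ { (inj₁ c) → fun c ; (inj₂ x) → id }
  }
  where open LC 𝒟

module _ (𝒟 : LC) where
  open LC 𝒟

  -- α₁ × ⋯ × αₖ
  funs : ∀ {k} (cs : Vec ∣ arcs ∣ k) →
         ∣ Πᶠ dom (Vec.map source cs) ∣ → ∣ Πᶠ dom (Vec.map target cs) ∣
  funs []       []       = []
  funs (c ∷ cs) (d ∷ ds) = fun c d ∷ funs cs ds

-- The maps σ : [m] → [k] are represented by their vectors of values.
module _ {X : Set} where

  infixl 8 _[_]
  _[_] : ∀ {k m} → Vec X k → Vec (Fin k) m → Vec X m
  xs [ σ ] = Vec.map (Vec.lookup xs) σ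

  infixl 8 _*
  _* : ∀ {P : X → Set} {k m} {xs : Vec X k} (σ : Vec (Fin k) m) →
       All P xs → All P (xs [ σ ])
  ([] *)      ds = []
  ((i ∷ σ) *) ds = lookup⁺ ds i ∷ (σ *) ds

pow : ℕ → LC → LC
pow k 𝒟 = record
  { vars   = vars ^ᶠ k
  ; dom    = Πᶠ dom
  ; arcs   = (arcs ^ᶠ k) ⊎ᶠ ((vars ^ᶠ k) ×ᶠ (Finᶠ k ^ᶠ k))
  ; source = [ Vec.map source , (λ (xs , σ) → xs) ]
  ; target = [ Vec.map target , (λ (xs , σ) → xs [ σ ]) ]
  ; fun    = λ { (inj₁ cs) → funs (addIdentities 𝒟) cs
               ; (inj₂ (xs , σ)) → σ * }
  }
  where open LC (addIdentities 𝒟)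

------------------------------------------------------------------------
-- Levels

mapFirst : {A B C : Set} → (A → B) → A × C → B × C
mapFirst f (a , c) = f a , c

mapSecond : {A C D : Set} → (C → D) → A × C → A × D
mapSecond f (a , c) = a , f c

-- β × id × ⋯ × id, on a product of k factors regarded as a product of
-- the first factor and the remaining ones.
mapHead : {X A : Set} {P : X → Set} {z : X} {n : ℕ} {ys : Vec X n} →
          (P z → A) → All P (z ∷ ys) → A × All P ys
mapHead β (e ∷ es) = β e , es

-- The identification of F y₁ × ⋯ × F yₙ with G y₁ × ⋯ × G yₙ for
-- families F and G with equal members.
transport : {X : Set} {F G : X → FinSet} → (∀ x → F x ≡ G x) →
            ∀ {n} {xs : Vec X n} → ∣ Πᶠ F xs ∣ → ∣ Πᶠ G xs ∣
transport q = All.map λ {x} → subst ∣_∣ (q x)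

module _ {X : Set} {F : X → FinSet} where

  transport-refl : ∀ {n} {xs : Vec X n} (es : ∣ Πᶠ F xs ∣) →
                   transport {F = F} (λ _ → refl) es ≡ es
  transport-refl []       = refl
  transport-refl (e ∷ es) = cong (e ∷_) (transport-refl es)

  transport-sym : {G : X → FinSet} (q : ∀ x → F x ≡ G x) →
                  ∀ {n} {xs : Vec X n} (es : ∣ Πᶠ F xs ∣) →
                  transport (sym ∘ q) (transport q es) ≡ es
  transport-sym q [] = refl
  transport-sym q (_∷_ {x = x} e es) =
    cong₂ _∷_ (subst-sym-subst (q x)) (transport-sym q es)

  transport-trans : {G H : X → FinSet} (p : ∀ x → F x ≡ G x) (q : ∀ x → G x ≡ H x) →
                    ∀ {n} {xs : Vec X n} (es : ∣ Πᶠ F xs ∣) →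
                    transport q (transport p es) ≡
                    transport (λ x → trans (p x) (q x)) es
  transport-trans p q [] = refl
  transport-trans p q (_∷_ {x = x} e es) =
    cong₂ _∷_ (subst-subst (p x)) (transport-trans p q es)

-- The level k = suc n.
module Lvl {c ℓ} (n : ℕ) (R : Minion c ℓ) where
  open Minion R

  record Triple (A : FinSet) : Set (lsuc lzero ⊔ c ⊔ ℓ) where
    constructor triple
    field
      Y  : FinSet
      E  : ∣ Y ∣ → FinSet
      r  : Solution (pow (suc n) (discrete Y E)) R
      ω  : (ys : Vec ∣ Y ∣ n) → Elem (A ×ᶠ Πᶠ E ys)
      ω-from-r : ∃[ z ] Σ (∣ E z ∣ → ∣ A ∣) λ β → ∀ ys →
        ω ys ≈ map (mapHead β) (val r (z ∷ ys))

  -- Equality of triples.  The domains of the two discrete instances are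
  -- compared one by one, as equality of set-valued families; the witness
  -- of ω-from-r is not part of the triple and is ignored.
  data _≋_ {A : FinSet} : Triple A → Triple A → Set (lsuc lzero ⊔ c ⊔ ℓ) where
    equal : ∀ {Y E E′ r r′ ω ω′ h h′} →
      (q : ∀ y → E y ≡ E′ y) →
      (∀ ys → map (transport q) (val r ys) ≈ val r′ ys) →
      (∀ ys → map (mapSecond (transport q)) (ω ys) ≈ ω′ ys) →
      triple Y E r ω h ≋ triple Y E′ r′ ω′ h′

  private
    module S A = Setoid (obj A)

    map-≗id : ∀ A {f : ∣ A ∣ → ∣ A ∣} → f ≗ id → ∀ {r} → map {A} {A} f r ≈ r
    map-≗id A p = S.trans A (map-cong p (S.refl A)) (map-id _)

    map-inverse : ∀ A B {f : ∣ A ∣ → ∣ B ∣} {g : ∣ B ∣ → ∣ A ∣} → g ∘ f ≗ id →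
                  ∀ {r s} → map {A} {B} f r ≈ s → map {B} {A} g s ≈ r
    map-inverse A B gf p =
      S.trans A (map-cong {B} {A} (λ _ → refl) (S.sym B p))
        (S.trans A (map-∘ _ _ _) (map-≗id A gf))

    map-compose : ∀ A B C {f : ∣ A ∣ → ∣ B ∣} {g : ∣ B ∣ → ∣ C ∣} {h : ∣ A ∣ → ∣ C ∣} →
                  g ∘ f ≗ h → ∀ {r s t} →
                  map {A} {B} f r ≈ s → map {B} {C} g s ≈ t → map {A} {C} h r ≈ t
    map-compose A B C gf p q =
      S.trans C (map-cong (sym ∘ gf) (S.refl A))
        (S.trans C (S.sym C (map-∘ _ _ _))
          (S.trans C (map-cong {B} {C} (λ _ → refl) p) q))

  ≋-refl : ∀ {A} {t : Triple A} → t ≋ t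
  ≋-refl {A} {triple Y E r ω h} = equal (λ _ → refl)
    (λ ys → map-≗id (Πᶠ E ys) (transport-refl {F = E}))
    (λ ys → map-≗id (A ×ᶠ Πᶠ E ys) λ (a , es) → cong (a ,_) (transport-refl {F = E} es))

  ≋-sym : ∀ {A} {t u : Triple A} → t ≋ u → u ≋ t
  ≋-sym {A} (equal {E = E} {E′} q p₁ p₂) = equal (sym ∘ q)
    (λ ys → map-inverse (Πᶠ E ys) (Πᶠ E′ ys) (transport-sym q) (p₁ ys))
    (λ ys → map-inverse (A ×ᶠ Πᶠ E ys) (A ×ᶠ Πᶠ E′ ys)
              (λ (a , es) → cong (a ,_) (transport-sym q es)) (p₂ ys))

  ≋-trans : ∀ {A} {t u v : Triple A} → t ≋ u → u ≋ v → t ≋ v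
  ≋-trans {A} (equal {E = E} {E′} q p₁ p₂) (equal {E′ = E″} q′ p₁′ p₂′) =
    equal (λ y → trans (q y) (q′ y))
    (λ ys → map-compose (Πᶠ E ys) (Πᶠ E′ ys) (Πᶠ E″ ys)
              (transport-trans q q′) (p₁ ys) (p₁′ ys))
    (λ ys → map-compose (A ×ᶠ Πᶠ E ys) (A ×ᶠ Πᶠ E′ ys) (A ×ᶠ Πᶠ E″ ys)
              (λ (a , es) → cong (a ,_) (transport-trans q q′ es)) (p₂ ys) (p₂′ ys))

  mapTriple : ∀ {A B} → (∣ A ∣ → ∣ B ∣) → Triple A → Triple B
  mapTriple {A} {B} α (triple Y E r ω (z , β , p)) = record
    { Y = Y
    ; E = E
    ; r = r
    ; ω = λ ys → map (mapFirst α) (ω ys)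
    ; ω-from-r = z , α ∘ β , λ ys → let C = B ×ᶠ Πᶠ E ys in
        S.trans C (map-cong (λ _ → refl) (p ys))
          (S.trans C (map-∘ _ _ _)
            (map-cong (λ { (_ ∷ _) → refl }) (S.refl (Πᶠ E (z ∷ ys)))))
    }

  mapTriple-cong : ∀ {A B} {α β : ∣ A ∣ → ∣ B ∣} {t u : Triple A} →
                   α ≗ β → t ≋ u → mapTriple {A} {B} α t ≋ mapTriple {A} {B} β u
  mapTriple-cong {A} {B} {β = β} αβ (equal {E = E} {E′} q p₁ p₂) =
    equal q p₁ λ ys → let C = B ×ᶠ Πᶠ E′ ys in
      S.trans C (map-∘ {A ×ᶠ Πᶠ E ys} {B ×ᶠ Πᶠ E ys} {C} _ _ _)
        (S.trans C
          (map-cong {A ×ᶠ Πᶠ E ys} {C} (λ (a , es) → cong (_, _) (αβ a)) (S.refl (A ×ᶠ Πᶠ E ys)))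
          (S.trans C
            (S.sym C (map-∘ {A ×ᶠ Πᶠ E ys} {A ×ᶠ Πᶠ E′ ys} {C} (mapFirst β) _ _))
            (map-cong {A ×ᶠ Πᶠ E′ ys} {C} (λ _ → refl) (p₂ ys))))

  mapTriple-id : ∀ {A} (t : Triple A) → mapTriple {A} {A} id t ≋ t
  mapTriple-id {A} (triple Y E r ω h) = equal (λ _ → refl)
    (λ ys → map-≗id (Πᶠ E ys) (transport-refl {F = E}))
    (λ ys → let B = A ×ᶠ Πᶠ E ys in S.trans B
      (map-≗id B λ (a , es) → cong (a ,_) (transport-refl {F = E} es))
      (map-≗id B λ _ → refl))

  mapTriple-∘ : ∀ {A B C} (α : ∣ B ∣ → ∣ C ∣) (β : ∣ A ∣ → ∣ B ∣) (t : Triple A) →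
                mapTriple {B} {C} α (mapTriple {A} {B} β t) ≋ mapTriple {A} {C} (α ∘ β) t
  mapTriple-∘ {A} {B} {C} α β (triple Y E r ω h) = equal (λ _ → refl)
    (λ ys → map-≗id (Πᶠ E ys) (transport-refl {F = E}))
    (λ ys → S.trans (C ×ᶠ Πᶠ E ys)
      (map-≗id (C ×ᶠ Πᶠ E ys) λ (a , es) → cong (a ,_) (transport-refl {F = E} es))
      (map-∘ _ _ _))

  level : Minion (lsuc lzero ⊔ c ⊔ ℓ) (lsuc lzero ⊔ c ⊔ ℓ)
  level = record
    { obj      = λ A → record
      { Carrier       = Triple A
      ; _≈_           = _≋_
      ; isEquivalence = record { refl = ≋-refl ; sym = ≋-sym ; trans = ≋-trans }
      }
    ; map      = λ {A} {B} → mapTriple {A} {B}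
    ; map-cong = λ {A} {B} → mapTriple-cong {A} {B}
    ; map-id   = mapTriple-id
    ; map-∘    = λ {A} {B} {C} → mapTriple-∘ {A} {B} {C}
    }

lvl : ∀ {c ℓ} (k : ℕ) .{{_ : NonZero k}} → Minion c ℓ →
      Minion (lsuc lzero ⊔ c ⊔ ℓ) (lsuc lzero ⊔ c ⊔ ℓ)
lvl (suc n) R = Lvl.level n R

{-# OPTIONS --safe #-}

-- From a solution of pow_k 𝒟, take the discrete instance on the variables
-- of 𝒟 itself as the common base of all triples, and let ω at x be read
-- off the entries whose first index is x.
--
-- Conversely, in a solution of 𝒟 in the level all triples have the same
-- base (ℰ, r), because maps of the level do not change it and 𝒟 is
-- connected.  So each x is represented by some (z , γ : ℰ_z → 𝒟_x), and a
-- tuple xs gets the value map (γ₁ × ⋯ × γₖ) (r at z₁ ⋯ zₖ).  Replacing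
-- the first of these representatives by another one of the same triple
-- does not change the value, since the tuple ω determines it; by the
-- constraints (2) the same holds for every position.  Hence the value does
-- not depend on the representatives, and the constraints of pow_k 𝒟 hold
-- because they send representatives to representatives.
-- No base is fixed in advance, as 𝒟 may be empty: the triple of the first
-- entry of xs serves as the base for xs.
module Submission where

open import Defs
open import Axiom.UniquenessOfIdentityProofs.WithK using (uip)
open import Data.Empty using (⊥-elim)
open import Data.Fin using (Fin; zero; suc; _≟_; punchIn; punchOut)
open import Data.Fin.Properties using (punchInᵢ≢i; punchIn-punchOut)
open import Data.Nat using (ℕ; zero; suc; NonZero)
open import Data.Product using (Σ; _,_; ∃-syntax; proj₁; proj₂)
open import Data.Sum using (inj₁; inj₂)
open import Data.Unit using (⊤; tt)
open import Data.Vec as Vec using (Vec; []; _∷_; lookup; tabulate)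
open import Data.Vec.Properties using (lookup∘tabulate)
open import Data.Vec.Relation.Binary.Pointwise.Inductive as Pointwise
  using (Pointwise; []; _∷_)
open import Data.Vec.Relation.Unary.All using (All; []; _∷_)
open import Data.Vec.Relation.Unary.All.Properties using (lookup⁺; lookup⁻; tabulate⁺)
open import Function using (_∘_; id; const; _⇔_; mk⇔)
open import Level using (_⊔_) renaming (suc to lsuc; zero to lzero)
open import Relation.Binary using (Setoid)
open import Relation.Binary.Construct.Closure.Equivalence using (gfold)
open import Relation.Binary.Construct.Closure.ReflexiveTransitive as Star
  using (Star; ε; _◅_)
open import Relation.Binary.PropositionalEquality
  using (_≡_; _≢_; refl; sym; trans; cong; cong₂; subst; _≗_)
open import Relation.Nullary using (yes; no)

-- Selecting coordinates of a product

module _ {X : Set} {P : X → Set} where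

  All-ext : ∀ {n} {xs : Vec X n} {ds es : All P xs} →
            (∀ i → lookup⁺ ds i ≡ lookup⁺ es i) → ds ≡ es
  All-ext {ds = []}    {[]}    p = refl
  All-ext {ds = _ ∷ _} {_ ∷ _} p = cong₂ _∷_ (p zero) (All-ext (p ∘ suc))

  lookup⁺∘lookup⁻ : ∀ {n} {xs : Vec X n} (f : ∀ i → P (lookup xs i)) i →
                    lookup⁺ (lookup⁻ {P = P} {xs = xs} f) i ≡ f i
  lookup⁺∘lookup⁻ {xs = _ ∷ _}  f zero    = refl
  lookup⁺∘lookup⁻ {xs = _ ∷ xs} f (suc i) = lookup⁺∘lookup⁻ {xs = xs} (f ∘ suc) i

  module _ {k : ℕ} {xs : Vec X k} where

    lookup-[] : ∀ {m} (σ : Vec (Fin k) m) → All P (xs [ σ ]) →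
                ∀ j → P (lookup xs (lookup σ j))
    lookup-[] (i ∷ σ) (d ∷ ds) zero    = d
    lookup-[] (i ∷ σ) (d ∷ ds) (suc j) = lookup-[] σ ds j

    lookup-[]-* : ∀ {m} (σ : Vec (Fin k) m) (ds : All P xs) j →
                  lookup-[] σ ((σ *) ds) j ≡ lookup⁺ ds (lookup σ j)
    lookup-[]-* (i ∷ σ) ds zero    = refl
    lookup-[]-* (i ∷ σ) ds (suc j) = lookup-[]-* σ ds j

    module _ {m} (σ : Vec (Fin k) m) (surj : ∀ i → ∃[ j ] lookup σ j ≡ i) where

      -- As `σ` is onto, every coordinate survives in `xs [ σ ]`; reading it at a chosen preimage
      -- inverts `σ *` from the left.
      unpermute : All P (xs [ σ ]) → All P xs
      unpermute ds = lookup⁻ λ i →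
        subst (P ∘ lookup xs) (proj₂ (surj i)) (lookup-[] σ ds (proj₁ (surj i)))

      unpermute-* : (ds : All P xs) → unpermute ((σ *) ds) ≡ ds
      unpermute-* ds = All-ext λ i → trans (lookup⁺∘lookup⁻ {xs = xs} _ i) (at i)
        where
        subst-lookup : ∀ {i j} (eq : j ≡ i) →
                       subst (P ∘ lookup xs) eq (lookup⁺ ds j) ≡ lookup⁺ ds i
        subst-lookup refl = refl

        at : ∀ i → subst (P ∘ lookup xs) (proj₂ (surj i))
                     (lookup-[] σ ((σ *) ds) (proj₁ (surj i))) ≡ lookup⁺ ds i
        at i = trans (cong (subst _ (proj₂ (surj i))) (lookup-[]-* σ ds _))
                     (subst-lookup (proj₂ (surj i)))

-- Position `i` comes first and the others follow in order, which turns a change at `i` into a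
-- change at the head.
toFront : ∀ {n} → Fin (suc n) → Vec (Fin (suc n)) (suc n)
toFront i = i ∷ tabulate (punchIn i)

toFront-surjective : ∀ {n} (i : Fin (suc n)) j → ∃[ m ] lookup (toFront i) m ≡ j
toFront-surjective i j with i ≟ j
... | yes i≡j = zero , i≡j
... | no  i≢j = suc (punchOut i≢j) ,
  trans (lookup∘tabulate (punchIn i) (punchOut i≢j)) (punchIn-punchOut i≢j)

-- Products of identity constraints

-- A map between products is the identity, up to propositional equality
-- of its domain and codomain.
data IsId {X : Set} {P : X → Set} {n} (xs : Vec X n) :
          ∀ {ys zs : Vec X n} → (All P ys → All P zs) → Set where
  isId : {f : All P xs → All P xs} → f ≗ id → IsId xs {xs} {xs} f

isId-∷ : ∀ {X : Set} {P : X → Set} {n} {x : X} {xs ys zs : Vec X n}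
         {f : All P ys → All P zs} {g : All P (x ∷ ys) → All P (x ∷ zs)} →
         (∀ d ds → g (d ∷ ds) ≡ d ∷ f ds) → IsId xs f → IsId (x ∷ xs) g
isId-∷ g-∷ (isId p) = isId λ { (d ∷ ds) → trans (g-∷ d ds) (cong (d ∷_) (p ds)) }

-- A discrete instance has no arcs, so only the added identities occur. The vectors of sources and
-- targets agree only propositionally, hence `IsId`.
funs-discrete : ∀ {Y F n} (cs : Vec _ n) →
                ∃[ ys ] IsId ys (funs (addIdentities (discrete Y F)) cs)
funs-discrete []            = [] , isId λ { [] → refl }
funs-discrete {Y} {F} (inj₂ y ∷ cs) with funs-discrete {Y} {F} cs
... | ys , p = y ∷ ys , isId-∷ (λ _ _ → refl) p

funs-identities : ∀ 𝒟 {n} (xs : Vec ∣ LC.vars 𝒟 ∣ n) →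
                  IsId xs (funs (addIdentities 𝒟) (Vec.map inj₂ xs))
funs-identities 𝒟 []       = isId λ { [] → refl }
funs-identities 𝒟 (x ∷ xs) = isId-∷ (λ _ _ → refl) (funs-identities 𝒟 xs)

module _ {X : Set} {F : X → FinSet} where

  -- Axiom K makes every loop `q x` trivial.
  transport-id : (q : ∀ x → F x ≡ F x) → ∀ {n} {xs : Vec X n} (ds : ∣ Πᶠ F xs ∣) →
                 transport q ds ≡ ds
  transport-id q []                 = refl
  transport-id q (_∷_ {x = x} d ds) =
    cong₂ _∷_ (cong (λ eq → subst ∣_∣ eq d) (uip (q x) refl)) (transport-id q ds)

-- Maps of a minion and equality of triples

module _ {c ℓ} (R : Minion c ℓ) where

  open Minion R

  private module S A = Setoid (obj A)

  map-congˡ : ∀ A B {f g : ∣ A ∣ → ∣ B ∣} → f ≗ g →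
              ∀ {r} → map {A} {B} f r ≈ map {A} {B} g r
  map-congˡ A B p = map-cong p (S.refl A)

  map-congʳ : ∀ A B {f : ∣ A ∣ → ∣ B ∣} {r s} → r ≈ s →
              map {A} {B} f r ≈ map {A} {B} f s
  map-congʳ A B p = map-cong (λ _ → refl) p

  map-≗id : ∀ A {f : ∣ A ∣ → ∣ A ∣} → f ≗ id → ∀ {r} → map {A} {A} f r ≈ r
  map-≗id A p = S.trans A (map-congˡ A A p) (map-id _)

  map-fuse : ∀ A B C {f : ∣ A ∣ → ∣ B ∣} {g : ∣ B ∣ → ∣ C ∣} {h : ∣ A ∣ → ∣ C ∣} →
             g ∘ f ≗ h → ∀ {r} → map {B} {C} g (map {A} {B} f r) ≈ map {A} {C} h r
  map-fuse A B C p = S.trans C (map-∘ _ _ _) (map-congˡ A C p)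

  map-square : ∀ A B B′ C {f : ∣ A ∣ → ∣ B ∣} {g : ∣ B ∣ → ∣ C ∣}
               {f′ : ∣ A ∣ → ∣ B′ ∣} {g′ : ∣ B′ ∣ → ∣ C ∣} → g ∘ f ≗ g′ ∘ f′ →
               ∀ {r} → map {B} {C} g (map {A} {B} f r) ≈ map {B′} {C} g′ (map {A} {B′} f′ r)
  map-square A B B′ C p =
    S.trans C (map-fuse A B C p) (S.sym C (map-∘ {A} {B′} {C} _ _ _))

  module _ (n : ℕ) where

    open Lvl n R

    ω-equal : ∀ {A Y E r ω ω′ h h′} → (∀ ys → ω ys ≈ ω′ ys) →
              _≋_ {A} (triple Y E r ω h) (triple Y E r ω′ h′)
    ω-equal {A} {E = E} p = equal (λ _ → refl)
      (λ ys → map-≗id (Πᶠ E ys) (transport-refl {F = E}))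
      (λ ys → let B = A ×ᶠ Πᶠ E ys in S.trans B
        (map-≗id B λ (a , ds) → cong (a ,_) (transport-refl {F = E} ds)) (p ys))

    -- Equality of triples may come with nontrivial-looking loops `q` on the domains; `transport-id`
    -- removes them.
    ω-cong : ∀ {A Y E r r′ ω ω′ h h′} →
             _≋_ {A} (triple Y E r ω h) (triple Y E r′ ω′ h′) → ∀ ys → ω ys ≈ ω′ ys
    ω-cong {A} {E = E} (equal q _ p) ys = S.trans B
      (S.sym B (map-≗id B λ (a , ds) → cong (a ,_) (transport-id {F = E} q ds)))
      (p ys)
      where B = A ×ᶠ Πᶠ E ys

    -- From the power to the level

    module _ (𝒟 : LC) (s : Solution (pow (suc n) 𝒟) R) where

      open LC 𝒟

      discreteSolution : Solution (pow (suc n) (discrete vars dom)) R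
      discreteSolution = record
        { val       = val s
        ; satisfied = λ
          { (inj₁ cs) → identity (proj₂ (funs-discrete cs))
          ; (inj₂ p)  → satisfied s (inj₂ p)
          }
        }
        where
        -- The index vectors are variables, so that matching on `isId` can unify them.
        identity : ∀ {xs ys zs} {f : ∣ Πᶠ dom ys ∣ → ∣ Πᶠ dom zs ∣} → IsId xs f →
                   val s zs ≈ map {Πᶠ dom ys} {Πᶠ dom zs} f (val s ys)
        identity {xs} (isId p) = S.sym (Πᶠ dom xs) (map-≗id (Πᶠ dom xs) p)

      -- This is constraint (1) with `a` in the first place and added identities in all others.
      head-constraint : ∀ a (ys : Vec ∣ vars ∣ n) →
        map {Πᶠ dom (target a ∷ ys)} {dom (target a) ×ᶠ Πᶠ dom ys} (mapHead id)
            (val s (target a ∷ ys)) ≈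
        map {Πᶠ dom (source a ∷ ys)} {dom (target a) ×ᶠ Πᶠ dom ys} (mapHead (fun a))
            (val s (source a ∷ ys))
      head-constraint a ys =
        go (funs-identities 𝒟 ys) (λ _ _ → refl)
           (satisfied s (inj₁ (inj₁ a ∷ Vec.map inj₂ ys)))
        where
        A = Πᶠ dom (source a ∷ ys)
        B = Πᶠ dom (target a ∷ ys)
        C = dom (target a) ×ᶠ Πᶠ dom ys

        go : ∀ {us vs} {f : ∣ Πᶠ dom us ∣ → ∣ Πᶠ dom vs ∣}
             {g : ∣ Πᶠ dom (source a ∷ us) ∣ → ∣ Πᶠ dom (target a ∷ vs) ∣} → IsId ys f →
             (∀ d ds → g (d ∷ ds) ≡ fun a d ∷ f ds) →
             val s (target a ∷ vs) ≈
               map {Πᶠ dom (source a ∷ us)} {Πᶠ dom (target a ∷ vs)} g (val s (source a ∷ us)) →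
             map {B} {C} (mapHead id) (val s (target a ∷ ys)) ≈
               map {A} {C} (mapHead (fun a)) (val s (source a ∷ ys))
        go {g = g} (isId p) g-∷ e = S.trans C (map-congʳ B C e) (map-fuse A B C mapHead-g)
          where
          mapHead-g : mapHead id ∘ g ≗ mapHead (fun a)
          mapHead-g (d ∷ ds) rewrite g-∷ d ds = cong (_ ,_) (p ds)

      pow⇒level : Solution 𝒟 level
      pow⇒level = record
        { val       = λ x → triple vars dom discreteSolution
            (λ ys → map (mapHead id) (val s (x ∷ ys)))
            (x , id , λ ys → S.refl (dom x ×ᶠ Πᶠ dom ys))
        ; satisfied = λ a → ω-equal λ ys →
            let A = Πᶠ dom (source a ∷ ys)
                B = dom (source a) ×ᶠ Πᶠ dom ys
                C = dom (target a) ×ᶠ Πᶠ dom ys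
            in S.trans C (head-constraint a ys)
                 (S.sym C (map-fuse A B C λ { (_ ∷ _) → refl }))
        }

    -- Representatives of a triple over a base

    module _ {Y : FinSet} {E : ∣ Y ∣ → FinSet}
             (r : Solution (pow (suc n) (discrete Y E)) R) where

      slot : ∀ {A} z → (∣ E z ∣ → ∣ A ∣) → Triple A
      slot {A} z γ = triple Y E r (λ ys → map (mapHead γ) (val r (z ∷ ys)))
        (z , γ , λ ys → S.refl (A ×ᶠ Πᶠ E ys))

      -- Comparing whole triples, and not only their ω, lets representatives follow chains of `≋`
      -- and ties the base of `t` to `r`.
      Rep : ∀ {A} → ∣ Y ∣ → Triple A → Set _
      Rep {A} z t = Σ (∣ E z ∣ → ∣ A ∣) λ γ → slot z γ ≋ t

      -- The index `z` stays and `γ` is composed with `α`, so a constraint of 𝒟 carries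
      -- representatives along without moving the entry of `r`.
      map-Rep : ∀ {A B} {α : ∣ A ∣ → ∣ B ∣} {t : Triple A} {u : Triple B} {z} →
                u ≋ mapTriple {A} {B} α t → Rep z t → Rep z u
      map-Rep {A} {B} {α} {z = z} e (γ , p) = α ∘ γ ,
        ≋-trans
          (ω-equal λ ys → S.sym (B ×ᶠ Πᶠ E ys)
            (map-fuse (Πᶠ E (z ∷ ys)) (A ×ᶠ Πᶠ E ys) (B ×ᶠ Πᶠ E ys) λ { (_ ∷ _) → refl }))
          (≋-trans (mapTriple-cong {A} {B} {α} {α} (λ _ → refl) p) (≋-sym e))

    ownRep : ∀ {A Y E r ω h} → Rep {Y} {E} r (proj₁ h) (triple {A} Y E r ω h)
    ownRep {A} {E = E} {h = z , β , p} =
      β , ω-equal λ ys → S.sym (A ×ᶠ Πᶠ E ys) (p ys)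

    module _ {Y E E′} {r : Solution (pow (suc n) (discrete Y E)) R}
             {r′ : Solution (pow (suc n) (discrete Y E′)) R}
             (q : ∀ y → E y ≡ E′ y)
             (e : ∀ ys → map (transport q) (val r ys) ≈ val r′ ys) where

      -- Equal bases have domains equal only up to `q`, so `γ` is precomposed with the transport.
      rebase : ∀ {A z} {t : Triple A} → Rep r′ z t → Rep r z t
      rebase {A} {z} (γ , p) = γ ∘ subst ∣_∣ (q z) ,
        ≋-trans (equal q e λ ys →
          let C = A ×ᶠ Πᶠ E′ ys
              D = Πᶠ E (z ∷ ys)
              D′ = Πᶠ E′ (z ∷ ys)
          in S.trans C (map-square D (A ×ᶠ Πᶠ E ys) D′ C λ { (_ ∷ _) → refl })
               (map-congʳ D′ C (e (z ∷ ys)))) p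

    -- Values of tuples of representatives

    module _ {X : Set} {F : X → FinSet} (T : ∀ x → Triple (F x)) where

      module _ {Y E} (r : Solution (pow (suc n) (discrete Y E)) R) where

        Reps : ∀ {m} → Vec ∣ Y ∣ m → Vec X m → Set _
        Reps = Pointwise λ z x → Rep r z (T x)

        apply : ∀ {m} {zs : Vec ∣ Y ∣ m} {xs} → Reps zs xs → ∣ Πᶠ E zs ∣ → ∣ Πᶠ F xs ∣
        apply []            []       = []
        apply ((γ , _) ∷ w) (d ∷ ds) = γ d ∷ apply w ds

        eval : ∀ {zs xs} → Reps zs xs → Elem (Πᶠ F xs)
        eval {zs} {xs} w = map {Πᶠ E zs} {Πᶠ F xs} (apply w) (val r zs)

        Tuple : ∀ {m} → Vec X m → Set _
        Tuple xs = ∃[ zs ] Reps zs xs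

        infixr 5 _∷ᵗ_
        _∷ᵗ_ : ∀ {m x} {xs : Vec X m} →
               (∃[ z ] Rep r z (T x)) → Tuple xs → Tuple (x ∷ xs)
        (z , u) ∷ᵗ (zs , w) = z ∷ zs , u ∷ w

        lookupᵗ : ∀ {m} {xs : Vec X m} → Tuple xs → ∀ i → ∃[ z ] Rep r z (T (lookup xs i))
        lookupᵗ (zs , w) i = lookup zs i , Pointwise.lookup w i

        evalᵗ : ∀ {xs} → Tuple xs → Elem (Πᶠ F xs)
        evalᵗ (_ , w) = eval w

        permute : ∀ {k m} {zs : Vec ∣ Y ∣ k} {xs} (σ : Vec (Fin k) m) →
                  Reps zs xs → Reps (zs [ σ ]) (xs [ σ ])
        permute []      w = []
        permute (i ∷ σ) w = Pointwise.lookup w i ∷ permute σ w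

        permuteᵗ : ∀ {k m} {xs : Vec X k} (σ : Vec (Fin k) m) → Tuple xs → Tuple (xs [ σ ])
        permuteᵗ σ (zs , w) = zs [ σ ] , permute σ w

        lookup-apply : ∀ {m} {zs : Vec ∣ Y ∣ m} {xs} (w : Reps zs xs) ds i →
          proj₁ (Pointwise.lookup w i) (lookup⁺ ds i) ≡ lookup⁺ (apply w ds) i
        lookup-apply (_ ∷ w) (d ∷ ds) zero    = refl
        lookup-apply (_ ∷ w) (d ∷ ds) (suc i) = lookup-apply w ds i

        apply-permute : ∀ {k m} {zs : Vec ∣ Y ∣ k} {xs} (σ : Vec (Fin k) m)
          (w : Reps zs xs) → apply (permute σ w) ∘ (σ *) ≗ (σ *) ∘ apply w
        apply-permute []      w ds = refl
        apply-permute (i ∷ σ) w ds = cong₂ _∷_ (lookup-apply w ds i) (apply-permute σ w ds)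

        -- Constraint (2) for `r` relates its entries at `zs` and `zs [ σ ]`; the rest is naturality
        -- of `apply`.
        eval-permute : ∀ {xs} σ (t : Tuple xs) →
          evalᵗ (permuteᵗ σ t) ≈ map {Πᶠ F xs} {Πᶠ F (xs [ σ ])} (σ *) (evalᵗ t)
        eval-permute {xs} σ (zs , w) = S.trans C (map-congʳ B C (satisfied r (inj₂ (zs , σ))))
          (map-square (Πᶠ E zs) B (Πᶠ F xs) C (apply-permute σ w))
          where
          B = Πᶠ E (zs [ σ ])
          C = Πᶠ F (xs [ σ ])

        -- The value factors through the ω of the slot of its first representative. Both slots equal
        -- `T x`, so these ω agree.
        eval-head : ∀ {x xs} (u v : ∃[ z ] Rep r z (T x)) (t : Tuple xs) →
                    evalᵗ (u ∷ᵗ t) ≈ evalᵗ (v ∷ᵗ t)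
        eval-head {x} {xs} u v (zs , w) = S.trans C (S.sym C (factor u))
          (S.trans C (map-congʳ B C (ω-cong (≋-trans (proj₂ (proj₂ u)) (≋-sym (proj₂ (proj₂ v)))) zs))
            (factor v))
          where
          B = F x ×ᶠ Πᶠ E zs
          C = Πᶠ F (x ∷ xs)

          tail : ∣ B ∣ → ∣ C ∣
          tail (a , ds) = a ∷ apply w ds

          factor : ∀ ((z , γ , p) : ∃[ z ] Rep r z (T x)) →
            map {B} {C} tail (map {Πᶠ E (z ∷ zs)} {B} (mapHead γ) (val r (z ∷ zs))) ≈
            eval ((γ , p) ∷ w)
          factor (z , _) = map-fuse (Πᶠ E (z ∷ zs)) B C λ { (_ ∷ _) → refl }

        -- Replacement of one representative; `steps` replaces all of them from left to right.
        data Step : ∀ {m} {xs : Vec X m} → Tuple xs → Tuple xs → Set (lsuc lzero ⊔ c ⊔ ℓ) where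
          here  : ∀ {m x} {xs : Vec X m} {u v : ∃[ z ] Rep r z (T x)} {t : Tuple xs} →
                  Step (u ∷ᵗ t) (v ∷ᵗ t)
          there : ∀ {m x} {xs : Vec X m} {u : ∃[ z ] Rep r z (T x)} {t t′ : Tuple xs} →
                  Step t t′ → Step (u ∷ᵗ t) (u ∷ᵗ t′)

        steps : ∀ {m} {xs : Vec X m} (t t′ : Tuple xs) → Star Step t t′
        steps (_ , [])    (_ , [])      = ε
        steps (_ , u ∷ w) (_ , u′ ∷ w′) =
          here ◅ Star.gmap ((_ , u′) ∷ᵗ_) there (steps (_ , w) (_ , w′))

        -- Away from `i` the representatives are equal including their proofs, so the permuted tails
        -- become propositionally equal.
        position : ∀ {m} {xs : Vec X m} {t t′ : Tuple xs} → Step t t′ →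
                   ∃[ i ] (∀ j → j ≢ i → lookupᵗ t j ≡ lookupᵗ t′ j)
        position here = zero , λ { zero 0≢0 → ⊥-elim (0≢0 refl) ; (suc j) _ → refl }
        position (there s) with position s
        ... | i , p = suc i , λ { zero _ → refl ; (suc j) j≢i → p j (j≢i ∘ cong suc) }

        permute-≡ : ∀ {k m} {xs : Vec X k} {t t′ : Tuple xs} {σ : Vec (Fin k) m} →
          All (λ j → lookupᵗ t j ≡ lookupᵗ t′ j) σ → permuteᵗ σ t ≡ permuteᵗ σ t′
        permute-≡ []       = refl
        permute-≡ (e ∷ es) = cong₂ _∷ᵗ_ e (permute-≡ es)

        -- Since map preserves left inverses, eval at permuted arguments
        -- determines eval at the original ones.
        eval-step : ∀ {xs} {t t′ : Tuple xs} → Step t t′ → evalᵗ t ≈ evalᵗ t′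
        eval-step {xs} {t} {t′} s =
          S.trans A (S.sym A (back t)) (S.trans A (map-congʳ B A front) (back t′))
          where
          i = proj₁ (position s)
          σ = toFront i
          A = Πᶠ F xs
          B = Πᶠ F (xs [ σ ])

          τ : ∣ B ∣ → ∣ A ∣
          τ = unpermute σ (toFront-surjective i)

          back : ∀ t → map {B} {A} τ (evalᵗ (permuteᵗ σ t)) ≈ evalᵗ t
          back t = S.trans A (map-congʳ B A (eval-permute σ t))
            (S.trans A (map-fuse A B A (unpermute-* σ (toFront-surjective i))) (map-id _))

          tails : permuteᵗ (tabulate (punchIn i)) t ≡ permuteᵗ (tabulate (punchIn i)) t′
          tails = permute-≡ (tabulate⁺ λ j → proj₂ (position s) _ (punchInᵢ≢i i j))

          front : evalᵗ (permuteᵗ σ t) ≈ evalᵗ (permuteᵗ σ t′)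
          -- By the form of `toFront`, the permuted tuple unfolds to the representative at `i`
          -- followed by the tail, so `eval-head` applies.
          front = subst (λ v → evalᵗ (permuteᵗ σ t) ≈ evalᵗ (lookupᵗ t′ i ∷ᵗ v)) tails
            (eval-head (lookupᵗ t i) (lookupᵗ t′ i) (permuteᵗ (tabulate (punchIn i)) t))

        eval-unique : ∀ {xs} (t t′ : Tuple xs) → evalᵗ t ≈ evalᵗ t′
        eval-unique {xs} t t′ = Star.fold (λ t t′ → evalᵗ t ≈ evalᵗ t′)
          (λ s → S.trans (Πᶠ F xs) (eval-step s)) (S.refl (Πᶠ F xs)) (steps t t′)

      module _ {Y E E′} {r : Solution (pow (suc n) (discrete Y E)) R}
               {r′ : Solution (pow (suc n) (discrete Y E′)) R}
               (q : ∀ y → E y ≡ E′ y)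
               (e : ∀ ys → map (transport q) (val r ys) ≈ val r′ ys) where

        apply-rebase : ∀ {m} {zs : Vec ∣ Y ∣ m} {xs} (w : Reps r′ zs xs) →
          apply r′ w ∘ transport q ≗ apply r (Pointwise.map (rebase q e) w)
        apply-rebase []      []       = refl
        apply-rebase (u ∷ w) (d ∷ ds) = cong (_ ∷_) (apply-rebase w ds)

        eval-rebase : ∀ {zs xs} (w : Reps r′ zs xs) →
          eval r (Pointwise.map (rebase q e) w) ≈ eval r′ w
        eval-rebase {zs} {xs} w = S.trans C
          (S.sym C (map-fuse (Πᶠ E zs) (Πᶠ E′ zs) C (apply-rebase w)))
          (map-congʳ (Πᶠ E′ zs) C (e zs))
          where C = Πᶠ F xs

    -- Comparing bases

    ⊤ᶠ : FinSet
    ⊤ᶠ = finSet ⊤ finite-⊤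

    -- Triples over different sets have different types; pushing them to a point makes them
    -- comparable and keeps `Y`, `E` and `r`.
    forget : ∀ {A} → Triple A → Triple ⊤ᶠ
    forget {A} = mapTriple {A} {⊤ᶠ} (const tt)

    SameBase : ∀ {A B} → Triple A → Triple B → Set _
    SameBase t u = forget t ≋ forget u

    represent : ∀ {A B} (b : Triple B) (t : Triple A) → SameBase b t →
                ∃[ z ] Rep (Triple.r b) z t
    represent (triple _ _ r _ _) (triple _ _ r′ _ h) (equal q e _) =
      proj₁ h , rebase {r = r} {r′} q e ownRep

    module _ {X : Set} {F : X → FinSet} (T : ∀ x → Triple (F x)) where

      -- The second tuple is rebased to the first base, where `eval-unique` applies.
      eval-unique-base : ∀ {A B} (b : Triple A) (b′ : Triple B) → SameBase b b′ →
        ∀ {xs} (t : Tuple T (Triple.r b) xs) (t′ : Tuple T (Triple.r b′) xs) →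
        evalᵗ T (Triple.r b) t ≈ evalᵗ T (Triple.r b′) t′
      eval-unique-base (triple _ _ r _ _) (triple _ _ r′ _ _) (equal q e _) {xs} t (zs , w) =
        S.trans (Πᶠ F xs)
          (eval-unique T r t (zs , Pointwise.map (rebase {r = r} {r′} q e) w))
          (eval-rebase T {r = r} {r′} q e w)

    -- From the level to the power

    module _ (𝒟 : LC) (connected : Connected 𝒟) (s : Solution 𝒟 level) where

      open LC 𝒟

      satisfied⁺ : ∀ a → val s (LC.target (addIdentities 𝒟) a) ≋
        mapTriple {dom (LC.source (addIdentities 𝒟) a)} {dom (LC.target (addIdentities 𝒟) a)}
          (LC.fun (addIdentities 𝒟) a) (val s (LC.source (addIdentities 𝒟) a))
      satisfied⁺ (inj₁ a) = satisfied s a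
      satisfied⁺ (inj₂ x) = ≋-sym (mapTriple-id (val s x))

      -- Any `α` followed by the map to a point is the map to a point, so `forget` is constant along
      -- each arc, hence along undirected paths.
      sameBase : ∀ x y → SameBase (val s x) (val s y)
      sameBase x y = gfold (Setoid.isEquivalence (Minion.obj level ⊤ᶠ)) (forget ∘ val s)
        (λ { (a , refl , refl) → ≋-sym (≋-trans
          (mapTriple-cong {dom (target a)} {⊤ᶠ} (λ _ → refl) (satisfied s a))
          (mapTriple-∘ {dom (source a)} {dom (target a)} {⊤ᶠ} _ _ (val s (source a)))) })
        (connected x y)

      base : ∀ x → Solution (pow (suc n) (discrete (Triple.Y (val s x)) (Triple.E (val s x)))) R
      base x = Triple.r (val s x)

      tuple : ∀ x {m} (xs : Vec ∣ vars ∣ m) → Tuple (val s) (base x) xs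
      tuple x []       = [] , []
      tuple x (y ∷ ys) = _∷ᵗ_ (val s) (base x)
        (represent (val s x) (val s y) (sameBase x y)) (tuple x ys)

      module _ {Y E} (r : Solution (pow (suc n) (discrete Y E)) R) where

        push : ∀ {m} (cs : Vec _ m) {zs} →
          Reps (val s) r zs (Vec.map (LC.source (addIdentities 𝒟)) cs) →
          Reps (val s) r zs (Vec.map (LC.target (addIdentities 𝒟)) cs)
        push []       []      = []
        push (a ∷ cs) (u ∷ w) = map-Rep r (satisfied⁺ a) u ∷ push cs w

        apply-push : ∀ {m} (cs : Vec _ m) {zs}
          (w : Reps (val s) r zs (Vec.map (LC.source (addIdentities 𝒟)) cs)) →
          funs (addIdentities 𝒟) cs ∘ apply (val s) r w ≗ apply (val s) r (push cs w)
        apply-push []       []      []       = refl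
        apply-push (a ∷ cs) (u ∷ w) (d ∷ ds) = cong (_ ∷_) (apply-push cs w ds)

      value : (xs : Vec ∣ vars ∣ (suc n)) → Elem (Πᶠ dom xs)
      value xs = evalᵗ (val s) (base (Vec.head xs)) (tuple (Vec.head xs) xs)

      -- A constraint can thus be checked over the base of the head of its source, although `value`
      -- at its target may use another base.
      value-unique : ∀ x {xs} (t : Tuple (val s) (base x) xs) → value xs ≈ evalᵗ (val s) (base x) t
      value-unique x {xs} t =
        eval-unique-base (val s) (val s (Vec.head xs)) (val s x) (sameBase _ x) _ t

      level⇒pow : Solution (pow (suc n) 𝒟) R
      level⇒pow = record
        { val       = value
        ; satisfied = λ
          { (inj₁ cs) →
              let xs = Vec.map (LC.source (addIdentities 𝒟)) cs
                  ys = Vec.map (LC.target (addIdentities 𝒟)) cs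
                  x  = Vec.head xs
                  (zs , w) = tuple x xs
              -- The pushed tuple keeps `zs`, so both sides are images of the same entry of
              -- `base x`.
              in S.trans (Πᶠ dom ys) (value-unique x (zs , push (base x) cs w))
                   (S.sym (Πᶠ dom ys)
                     (map-fuse (Πᶠ (Triple.E (val s x)) zs) (Πᶠ dom xs) (Πᶠ dom ys)
                       (apply-push (base x) cs w)))
          ; (inj₂ (xs , σ)) →
              let x = Vec.head xs
                  t = tuple x xs
              in S.trans (Πᶠ dom (xs [ σ ]))
                   (value-unique x (permuteᵗ (val s) (base x) σ t))
                   (eval-permute (val s) (base x) σ t)
          }
        }

theorem3p3 : ∀ {c ℓ} (R : Minion c ℓ) (k : ℕ) .{{_ : NonZero k}}
    (𝒟 : LC) → Connected 𝒟 →
    Solution (pow k 𝒟) R ⇔ Solution 𝒟 (lvl k R)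
theorem3p3 R (suc n) 𝒟 connected = mk⇔ (pow⇒level R n 𝒟) (level⇒pow R n 𝒟 connected)
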